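{- Let $G(V, E, w)$ be an undirected bipartite social network with $w_{ii} = 0$ for all buyers $i$, and let $(A, V \setminus A)$ be any partition of $V$ into independent sets. Then $\mathrm{IE}(A, 1/2)$ extracts the maximum revenue of $G$, i.e., $R_{\mathrm{IE}}(A,1/2) = R_{\max}(G)$.
   Context: An undirected social network $G(V,E,w)$ on a finite set $V$ of $n$ buyers has real weights $w_{ij} = w_{ji} \geq 0$ for distinct $i,j \in V$ (positive exactly on the edges) and a weight $w_{ii} \geq 0$ for each $i \in V$. Marketing strategies (Uniform Additive Model). A marketing strategy $(\vec{\pi},\vec{p})$ consists of a permutation $\vec{\pi}$ of $V$ ($\pi_i$ is the position of buyer $i$) and a vector $\vec{p}$ of pricing probabilities $p_i \in [1/2,1]$. Its expected revenue is $$R(\vec{\pi},\vec{p}) = \sum_{i\in V} p_i(1-p_i)\Big(w_{ii} + \sum_{j:\pi_j<\pi_i} p_j w_{ji}\Big),$$ and $R_{\max}(G) = \max_{(\vec{\pi},\vec{p})} R(\vec{\pi},\vec{p})$ is the maximum revenue of $G$. IE strategies. For $A \subseteq V$ and $p \in [1/2,1)$, the Influence-and-Exploit strategy $\mathrm{IE}(A,p)$ gives the product for free to the buyers in $A$ and then approaches the buyers in $V\setminus A$ in uniformly random order with pricing probability $p$. Its expected revenue is $$R_{\mathrm{IE}}(A,p) = p(1-p)\sum_{i\in V\setminus A}\Big(w_{ii} + \sum_{j\in A} w_{ji} + \sum_{j\in V\setminus A,\ j\neq i} \frac{p\,w_{ji}}{2}\Big).$$ -}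

module Defs where

open import Algebra.Bundles using (RawRing)
import Algebra.Definitions.RawMonoid as RawMonoidDefinitions
open import Data.Bool.Base using (if_then_else_)
open import Data.Fin.Base using (Fin)
open import Data.Fin.Permutation using (Permutation′; _⟨$⟩ʳ_)
import Data.Fin.Properties as Fin
open import Data.Fin.Subset using (Subset; _∈_; ∁)
open import Data.Fin.Subset.Properties using (_∈?_)
open import Data.Nat.Base using (ℕ; _⊔_)
import Data.Nat.Base as ℕ
import Data.Nat.Properties as ℕ
open import Data.Product.Base using (∃; _×_; _,_)
open import Data.Rational.Base using (ℚ; 0ℚ; 1ℚ)
import Data.Rational.Base as ℚ
import Data.Rational.Properties as ℚ
open import Data.Rational.Solver using (module +-*-Solver)
open import Level using (0ℓ)
open import Relation.Binary.PropositionalEquality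
  using (_≡_; _≢_; refl; sym; cong; subst)
open import Relation.Nullary.Decidable using (does; ¬?; _×-dec_)
open import Relation.Nullary.Negation using (¬_)
open import Relation.Unary using (Pred; Decidable)

------------------------------------------------------------------------
-- Real numbers: Cauchy sequences of rationals, up to the equality _≃_.

Eventually : Pred ℕ 0ℓ → Set
Eventually P = ∃ λ N → ∀ n → N ℕ.≤ n → P n

Cauchy : (ℕ → ℚ) → Set
Cauchy s = ∀ ε → 0ℚ ℚ.< ε →
  ∃ λ N → ∀ m n → N ℕ.≤ m → N ℕ.≤ n → ℚ.∣ s m ℚ.- s n ∣ ℚ.≤ ε

record ℝ : Set where
  constructor mkℝ
  field
    seq    : ℕ → ℚ
    cauchy : Cauchy seq

open ℝ public

infix 4 _≃_ _≤_ _<_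

_≃_ : ℝ → ℝ → Set
x ≃ y = ∀ ε → 0ℚ ℚ.< ε → Eventually λ n → ℚ.∣ seq x n ℚ.- seq y n ∣ ℚ.≤ ε

_≤_ : ℝ → ℝ → Set
x ≤ y = ∀ ε → 0ℚ ℚ.< ε → Eventually λ n → seq x n ℚ.≤ seq y n ℚ.+ ε

_<_ : ℝ → ℝ → Set
x < y = ∃ λ ε → 0ℚ ℚ.< ε × Eventually λ n → seq x n ℚ.+ ε ℚ.≤ seq y n

abstract
  ½-split : ∀ ε → ε ℚ.* ℚ.½ ℚ.+ ε ℚ.* ℚ.½ ≡ ε
  ½-split = solve 1 (λ ε → ε :* con ℚ.½ :+ ε :* con ℚ.½ := ε) refl
    where open +-*-Solver

  ½-pos : ∀ {ε} → 0ℚ ℚ.< ε → 0ℚ ℚ.< ε ℚ.* ℚ.½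
  ½-pos 0<ε = ℚ.*-monoˡ-<-pos ℚ.½ 0<ε

  const-cauchy : ∀ q → Cauchy (λ _ → q)
  const-cauchy q ε 0<ε = 0 , λ _ _ _ _ →
    subst (λ r → ℚ.∣ r ∣ ℚ.≤ ε) (sym (ℚ.+-inverseʳ q)) (ℚ.<⇒≤ 0<ε)

  +-cauchy : ∀ {s t} → Cauchy s → Cauchy t → Cauchy (λ n → s n ℚ.+ t n)
  +-cauchy {s} {t} cs ct ε 0<ε with cs _ (½-pos 0<ε) | ct _ (½-pos 0<ε)
  ... | M , hs | N , ht = M ⊔ N , λ m n ≤m ≤n → let open ℚ.≤-Reasoning in begin
    ℚ.∣ (s m ℚ.+ t m) ℚ.- (s n ℚ.+ t n) ∣
      ≡⟨ cong ℚ.∣_∣ (rearrange (s m) (t m) (s n) (t n)) ⟩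
    ℚ.∣ (s m ℚ.- s n) ℚ.+ (t m ℚ.- t n) ∣
      ≤⟨ ℚ.∣p+q∣≤∣p∣+∣q∣ (s m ℚ.- s n) (t m ℚ.- t n) ⟩
    ℚ.∣ s m ℚ.- s n ∣ ℚ.+ ℚ.∣ t m ℚ.- t n ∣
      ≤⟨ ℚ.+-mono-≤
           (hs m n (ℕ.m⊔n≤o⇒m≤o M N ≤m) (ℕ.m⊔n≤o⇒m≤o M N ≤n))
           (ht m n (ℕ.m⊔n≤o⇒n≤o M N ≤m) (ℕ.m⊔n≤o⇒n≤o M N ≤n)) ⟩
    ε ℚ.* ℚ.½ ℚ.+ ε ℚ.* ℚ.½
      ≡⟨ ½-split ε ⟩
    ε ∎
    where
    open +-*-Solver
    rearrange : ∀ a b c d →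
      (a ℚ.+ b) ℚ.- (c ℚ.+ d) ≡ (a ℚ.- c) ℚ.+ (b ℚ.- d)
    rearrange = solve 4
      (λ a b c d → (a :+ b) :- (c :+ d) := (a :- c) :+ (b :- d)) refl

  neg-cauchy : ∀ {s} → Cauchy s → Cauchy (λ n → ℚ.- s n)
  neg-cauchy {s} cs ε 0<ε with cs ε 0<ε
  ... | N , hs = N , λ m n ≤m ≤n → let open ℚ.≤-Reasoning in begin
    ℚ.∣ (ℚ.- s m) ℚ.- (ℚ.- s n) ∣  ≡⟨ cong ℚ.∣_∣ (ℚ.neg-distrib-+ (s m) (ℚ.- s n)) ⟨
    ℚ.∣ ℚ.- (s m ℚ.- s n) ∣        ≡⟨ ℚ.∣-p∣≡∣p∣ (s m ℚ.- s n) ⟩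
    ℚ.∣ s m ℚ.- s n ∣              ≤⟨ hs m n ≤m ≤n ⟩
    ε                              ∎

  cauchy-bounded : ∀ {s} → Cauchy s →
    ∃ λ B → 0ℚ ℚ.< B × Eventually λ n → ℚ.∣ s n ∣ ℚ.≤ B
  cauchy-bounded {s} cs with cs 1ℚ (ℚ.positive⁻¹ 1ℚ)
  ... | N , hs = 1ℚ ℚ.+ ℚ.∣ s N ∣
      , ℚ.+-mono-<-≤ (ℚ.positive⁻¹ 1ℚ) (ℚ.0≤∣p∣ (s N))
      , N , λ n ≤n → let open ℚ.≤-Reasoning in begin
    ℚ.∣ s n ∣                          ≡⟨ cong ℚ.∣_∣ (insert (s n) (s N)) ⟩
    ℚ.∣ (s n ℚ.- s N) ℚ.+ s N ∣        ≤⟨ ℚ.∣p+q∣≤∣p∣+∣q∣ (s n ℚ.- s N) (s N) ⟩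
    ℚ.∣ s n ℚ.- s N ∣ ℚ.+ ℚ.∣ s N ∣    ≤⟨ ℚ.+-monoˡ-≤ ℚ.∣ s N ∣ (hs n N ≤n ℕ.≤-refl) ⟩
    1ℚ ℚ.+ ℚ.∣ s N ∣                   ∎
    where
    open +-*-Solver
    insert : ∀ a b → a ≡ (a ℚ.- b) ℚ.+ b
    insert = solve 2 (λ a b → a := (a :- b) :+ b) refl

  *-mono-∣∣ : ∀ p q B δ → ℚ.∣ p ∣ ℚ.≤ B → ℚ.∣ q ∣ ℚ.≤ δ → 0ℚ ℚ.≤ δ →
    ℚ.∣ p ℚ.* q ∣ ℚ.≤ B ℚ.* δ
  *-mono-∣∣ p q B δ p≤B q≤δ 0≤δ = begin
    ℚ.∣ p ℚ.* q ∣        ≡⟨ ℚ.∣p*q∣≡∣p∣*∣q∣ p q ⟩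
    ℚ.∣ p ∣ ℚ.* ℚ.∣ q ∣  ≤⟨ ℚ.*-monoˡ-≤-nonNeg ℚ.∣ p ∣ {{ℚ.nonNegative (ℚ.0≤∣p∣ p)}} q≤δ ⟩
    ℚ.∣ p ∣ ℚ.* δ        ≤⟨ ℚ.*-monoʳ-≤-nonNeg δ {{ℚ.nonNegative 0≤δ}} p≤B ⟩
    B ℚ.* δ              ∎
    where open ℚ.≤-Reasoning

  divide : ∀ {B ε} → 0ℚ ℚ.< B → 0ℚ ℚ.< ε →
    ∃ λ δ → 0ℚ ℚ.< δ × B ℚ.* δ ≡ ε
  divide {B} {ε} 0<B 0<ε = B⁻¹ ℚ.* ε , 0<δ , Bδ≡ε
    where
    instance
      B-pos : ℚ.Positive B
      B-pos = ℚ.positive 0<B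
      ε-pos : ℚ.Positive ε
      ε-pos = ℚ.positive 0<ε
      B≢0 : ℚ.NonZero B
      B≢0 = ℚ.pos⇒nonZero B
    B⁻¹ : ℚ
    B⁻¹ = ℚ.1/ B
    0<δ : 0ℚ ℚ.< B⁻¹ ℚ.* ε
    0<δ = ℚ.positive⁻¹ _ {{ℚ.pos*pos⇒pos B⁻¹ {{ℚ.1/pos⇒pos B}} ε}}
    open ℚ.≤-Reasoning
    Bδ≡ε : B ℚ.* (B⁻¹ ℚ.* ε) ≡ ε
    Bδ≡ε = begin-equality
      B ℚ.* (B⁻¹ ℚ.* ε)  ≡⟨ ℚ.*-assoc B B⁻¹ ε ⟨
      B ℚ.* B⁻¹ ℚ.* ε    ≡⟨ cong (ℚ._* ε) (ℚ.*-inverseʳ B) ⟩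
      1ℚ ℚ.* ε           ≡⟨ ℚ.*-identityˡ ε ⟩
      ε                  ∎

  *-diff-bound : ∀ a b c d B C δ → 0ℚ ℚ.≤ δ →
    ℚ.∣ a ∣ ℚ.≤ B → ℚ.∣ d ∣ ℚ.≤ C →
    ℚ.∣ b ℚ.- d ∣ ℚ.≤ δ → ℚ.∣ a ℚ.- c ∣ ℚ.≤ δ →
    ℚ.∣ a ℚ.* b ℚ.- c ℚ.* d ∣ ℚ.≤ (B ℚ.+ C) ℚ.* δ
  *-diff-bound a b c d B C δ 0≤δ a≤B d≤C b-d≤δ a-c≤δ = begin
    ℚ.∣ a ℚ.* b ℚ.- c ℚ.* d ∣
      ≡⟨ cong ℚ.∣_∣ (rearrange a b c d) ⟩
    ℚ.∣ a ℚ.* (b ℚ.- d) ℚ.+ d ℚ.* (a ℚ.- c) ∣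
      ≤⟨ ℚ.∣p+q∣≤∣p∣+∣q∣ (a ℚ.* (b ℚ.- d)) (d ℚ.* (a ℚ.- c)) ⟩
    ℚ.∣ a ℚ.* (b ℚ.- d) ∣ ℚ.+ ℚ.∣ d ℚ.* (a ℚ.- c) ∣
      ≤⟨ ℚ.+-mono-≤ (*-mono-∣∣ a (b ℚ.- d) B δ a≤B b-d≤δ 0≤δ)
                    (*-mono-∣∣ d (a ℚ.- c) C δ d≤C a-c≤δ 0≤δ) ⟩
    B ℚ.* δ ℚ.+ C ℚ.* δ
      ≡⟨ ℚ.*-distribʳ-+ δ B C ⟨
    (B ℚ.+ C) ℚ.* δ ∎
    where
    open ℚ.≤-Reasoning
    open +-*-Solver
    rearrange : ∀ a b c d →
      a ℚ.* b ℚ.- c ℚ.* d ≡ a ℚ.* (b ℚ.- d) ℚ.+ d ℚ.* (a ℚ.- c)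
    rearrange = solve 4
      (λ a b c d → a :* b :- c :* d := a :* (b :- d) :+ d :* (a :- c)) refl

  *-cauchy : ∀ {s t} → Cauchy s → Cauchy t → Cauchy (λ n → s n ℚ.* t n)
  *-cauchy {s} {t} cs ct ε 0<ε =
    let B , 0<B , K , s≤B   = cauchy-bounded cs
        C , 0<C , L , t≤C   = cauchy-bounded ct
        δ , 0<δ , [B+C]δ≡ε = divide {B ℚ.+ C} (ℚ.+-mono-< 0<B 0<C) 0<ε
        M , hs              = cs δ 0<δ
        N , ht              = ct δ 0<δ
    in (K ⊔ L) ⊔ (M ⊔ N) , λ m n ≤m ≤n →
    let ≤m₁ = ℕ.m⊔n≤o⇒m≤o (K ⊔ L) (M ⊔ N) ≤m
        ≤n₁ = ℕ.m⊔n≤o⇒m≤o (K ⊔ L) (M ⊔ N) ≤n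
        ≤m₂ = ℕ.m⊔n≤o⇒n≤o (K ⊔ L) (M ⊔ N) ≤m
        ≤n₂ = ℕ.m⊔n≤o⇒n≤o (K ⊔ L) (M ⊔ N) ≤n
    in ℚ.≤-trans
      (*-diff-bound (s m) (t m) (s n) (t n) B C δ (ℚ.<⇒≤ 0<δ)
        (s≤B m (ℕ.m⊔n≤o⇒m≤o K L ≤m₁))
        (t≤C n (ℕ.m⊔n≤o⇒n≤o K L ≤n₁))
        (ht m n (ℕ.m⊔n≤o⇒n≤o M N ≤m₂) (ℕ.m⊔n≤o⇒n≤o M N ≤n₂))
        (hs m n (ℕ.m⊔n≤o⇒m≤o M N ≤m₂) (ℕ.m⊔n≤o⇒m≤o M N ≤n₂)))
      (ℚ.≤-reflexive [B+C]δ≡ε)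

infix  8 -_
infixl 7 _*_
infixl 6 _+_ _-_

fromℚ : ℚ → ℝ
fromℚ q = mkℝ (λ _ → q) (const-cauchy q)

0ℝ 1ℝ ½ : ℝ
0ℝ = fromℚ 0ℚ
1ℝ = fromℚ 1ℚ
½  = fromℚ ℚ.½

_+_ : ℝ → ℝ → ℝ
x + y = mkℝ (λ n → seq x n ℚ.+ seq y n) (+-cauchy {seq x} {seq y} (cauchy x) (cauchy y))

_*_ : ℝ → ℝ → ℝ
x * y = mkℝ (λ n → seq x n ℚ.* seq y n) (*-cauchy {seq x} {seq y} (cauchy x) (cauchy y))

-_ : ℝ → ℝ
- x = mkℝ (λ n → ℚ.- seq x n) (neg-cauchy {seq x} (cauchy x))

_-_ : ℝ → ℝ → ℝ
x - y = x + (- y)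

ℝ-rawRing : RawRing 0ℓ 0ℓ
ℝ-rawRing = record
  { Carrier = ℝ
  ; _≈_     = _≃_
  ; _+_     = _+_
  ; _*_     = _*_
  ; -_      = -_
  ; 0#      = 0ℝ
  ; 1#      = 1ℝ
  }

open RawMonoidDefinitions (RawRing.+-rawMonoid ℝ-rawRing) public using (sum)

sumOver : ∀ {n} {P : Pred (Fin n) 0ℓ} → Decidable P → (Fin n → ℝ) → ℝ
sumOver P? f = sum λ j → if does (P? j) then f j else 0ℝ

------------------------------------------------------------------------
-- Social networks

record Network (n : ℕ) : Set where
  field
    w        : Fin n → Fin n → ℝ
    w-sym    : ∀ i j → w i j ≃ w j i
    w-nonneg : ∀ i j → 0ℝ ≤ w i j

  Edge : Fin n → Fin n → Set
  Edge i j = i ≢ j × 0ℝ < w i j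

  Independent : Subset n → Set
  Independent S = ∀ {i j} → i ∈ S → j ∈ S → ¬ Edge i j

  -- A subset A stands for the partition (A , ∁ A) of the buyers.
  IsBipartition : Subset n → Set
  IsBipartition A = Independent A × Independent (∁ A)

  Bipartite : Set
  Bipartite = ∃ IsBipartition

------------------------------------------------------------------------
-- Marketing strategies in the Uniform Additive Model

record Strategy (n : ℕ) : Set where
  field
    π   : Permutation′ n
    p   : Fin n → ℝ
    ½≤p : ∀ i → ½ ≤ p i
    p≤1 : ∀ i → p i ≤ 1ℝ

module _ {n : ℕ} (G : Network n) where
  open Network G

  revenue : Strategy n → ℝ
  revenue σ = sum λ i →
    p i * (1ℝ - p i) *
      (w i i + sumOver (λ j → (π ⟨$⟩ʳ j) Fin.<? (π ⟨$⟩ʳ i)) (λ j → p j * w j i))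
    where open Strategy σ

  -- "r is R_max": the maximum over the infinite set of strategies is
  -- specified rather than computed; _≃_-unique since _≤_ is antisymmetric.
  IsMaximumRevenue : ℝ → Set
  IsMaximumRevenue r = (∃ λ σ → revenue σ ≃ r) × (∀ σ → revenue σ ≤ r)

  revenueIE : Subset n → ℝ → ℝ
  revenueIE A p = p * (1ℝ - p) * sumOver (_∈? ∁ A) λ i →
    w i i
      + sumOver (_∈? A) (λ j → w j i)
      + sumOver (λ j → (j ∈? ∁ A) ×-dec ¬? (j Fin.≟ i)) (λ j → ½ * (p * w j i))

-- An edge {i , j} whose later endpoint is i contributes p_i (1 - p_i) p_j w_ij,
-- which is at most w_ij / 4. For every order π and every pair {i , j}, at most
-- one of "j before i" and "i before j" holds, and only pairs across the
-- bipartition have nonzero weight; hence R is at most a quarter of the weight of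
-- the cut. Offering the product for free to A first, and then at probability ½ to
-- the rest, collects exactly w_ij / 4 on each edge, since an edge is always
-- completed by its endpoint outside A.

module Submission where

open import Algebra.Bundles using (CommutativeSemiring)
import Algebra.Properties.Semiring.Sum as SemiringSum
open import Algebra.Structures.Biased using (isCommutativeSemiringˡ; isCommutativeMonoidˡ)
open import Data.Bool.Base using (if_then_else_)
open import Data.Fin.Base using (Fin; zero; suc; fromℕ; punchIn)
import Data.Fin.Base as Fin
open import Data.Fin.Permutation using (Permutation′; _⟨$⟩ʳ_; insert)
import Data.Fin.Permutation as Permutation
import Data.Fin.Properties as Fin
open import Data.Fin.Subset using (Subset; _∈_; _∉_; ∁; inside; outside)
open import Data.Fin.Subset.Properties using (_∈?_; x∉p⇒x∈∁p; x∈∁p⇒x∉p)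
open import Data.Nat.Base using (ℕ; _⊔_; z<s; s<s)
import Data.Nat.Base as ℕ
import Data.Nat.Properties as ℕ
open import Data.Product.Base using (∃; _,_; proj₁; proj₂)
open import Data.Rational.Base using (ℚ; 0ℚ)
import Data.Rational.Base as ℚ
import Data.Rational.Properties as ℚ
open import Data.Rational.Solver using (module +-*-Solver)
open import Data.Sum.Base using (_⊎_; inj₁; inj₂)
open import Data.Vec.Base using ([]; _∷_; here; there)
open import Level using (0ℓ)
open import Relation.Binary.Core using (Rel)
open import Relation.Binary.Bundles using (Poset)
open import Relation.Binary.PropositionalEquality.Core as ≡
  using (_≡_; cong; subst)
import Relation.Binary.Reasoning.PartialOrder as PosetReasoning
open import Relation.Binary.Structures using (IsPartialOrder)
open import Relation.Nullary.Decidable using (Dec; yes; no; does; ¬?; _×-dec_)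
open import Relation.Nullary.Negation using (¬_; contradiction)

-- Weighted cuts over an ordered semiring

-- The comparison of double sums uses neither subtraction nor division, only cancellation of a
-- doubling. Keeping `_≈_` and `_≤_` abstract also lets their arguments be inferred, which fails
-- once they unfold to sequences.
record OrderedSemiring : Set₁ where
  field
    commutativeSemiring : CommutativeSemiring 0ℓ 0ℓ
  open CommutativeSemiring commutativeSemiring public
    hiding (zero; refl; sym; trans; reflexive; isEquivalence; isPartialEquivalence)
  infix 4 _≤_
  field
    _≤_            : Rel Carrier 0ℓ
    isPartialOrder : IsPartialOrder _≈_ _≤_
    +-mono-≤       : ∀ {x y u v} → x ≤ y → u ≤ v → x + u ≤ y + v
    *-monoʳ-≤      : ∀ {x y z} → 0# ≤ z → x ≤ y → x * z ≤ y * z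
    x+x≤y+y⇒x≤y    : ∀ {x y} → x + x ≤ y + y → x ≤ y

  poset : Poset 0ℓ 0ℓ 0ℓ
  poset = record { isPartialOrder = isPartialOrder }

  open Poset poset public using (module Eq; refl; reflexive; trans)

if-yes : ∀ {A P : Set} {x y : A} (d : Dec P) → P → (if does d then x else y) ≡ x
if-yes (yes _) _  = ≡.refl
if-yes (no ¬p) p = contradiction p ¬p

if-no : ∀ {A P : Set} {x y : A} (d : Dec P) → ¬ P → (if does d then x else y) ≡ y
if-no (yes p) ¬p = contradiction p ¬p
if-no (no _)  _  = ≡.refl

∈⊎∈∁ : ∀ {n} (A : Subset n) i → i ∈ A ⊎ i ∈ ∁ A
∈⊎∈∁ A i with i ∈? A
... | yes i∈A = inj₁ i∈A
... | no  i∉A = inj₂ (x∉p⇒x∈∁p i∉A)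

module WeightedCut (O : OrderedSemiring) where
  open OrderedSemiring O
  open SemiringSum semiring
    using (sum; sum-cong-≋; sum-replicate-zero; ∑-distrib-+; ∑-comm; *-distribˡ-sum)
  open PosetReasoning poset

  infix 8 [_]_
  -- This has the same shape as the summand of `sumOver`, so over `ℝ` the sums below agree
  -- definitionally with those in `revenue` and `revenueIE`.
  [_]_ : ∀ {P : Set} → Dec P → Carrier → Carrier
  [ d ] x = if does d then x else 0#

  []-cong : ∀ {P : Set} {x y} (d : Dec P) → (P → x ≈ y) → [ d ] x ≈ [ d ] y
  []-cong (yes p) x≈y = x≈y p
  []-cong (no _)  _   = Eq.refl

  []-mono-≤ : ∀ {P : Set} {x y} (d : Dec P) → x ≤ y → [ d ] x ≤ [ d ] y
  []-mono-≤ (yes _) x≤y = x≤y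
  []-mono-≤ (no _)  _   = refl

  []-nonneg : ∀ {P : Set} {x} (d : Dec P) → 0# ≤ x → 0# ≤ [ d ] x
  []-nonneg (yes _) 0≤x = 0≤x
  []-nonneg (no _)  _   = refl

  []-zero : ∀ {P : Set} {x} (d : Dec P) → (P → x ≈ 0#) → [ d ] x ≈ 0#
  []-zero (yes p) x≈0 = x≈0 p
  []-zero (no _)  _   = Eq.refl

  -- At most one indicator is on. With neither on, as for a buyer paired with itself in an order,
  -- the bound rests on `0# ≤ x`.
  []-disjoint-≤ : ∀ {P Q : Set} {x y} (d : Dec P) (e : Dec Q) → (P → ¬ Q) →
    x ≈ y → 0# ≤ x → [ d ] x + [ e ] y ≤ x
  []-disjoint-≤ (yes p) (yes q) ¬pq _   _   = contradiction q (¬pq p)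
  []-disjoint-≤ (yes _) (no _)  _   _   _   = reflexive (+-identityʳ _)
  []-disjoint-≤ (no _)  (yes _) _   x≈y _   =
    reflexive (Eq.trans (+-identityˡ _) (Eq.sym x≈y))
  []-disjoint-≤ (no _)  (no _)  _   _   0≤x = trans (reflexive (+-identityˡ 0#)) 0≤x

  sum-zero : ∀ {n} {f : Fin n → Carrier} → (∀ i → f i ≈ 0#) → sum f ≈ 0#
  sum-zero {n} f≈0 = Eq.trans (sum-cong-≋ f≈0) (sum-replicate-zero n)

  []-sum : ∀ {P : Set} {n} (d : Dec P) (f : Fin n → Carrier) →
    [ d ] sum f ≈ sum (λ j → [ d ] f j)
  []-sum         (yes _) f = Eq.refl
  []-sum {n = n} (no _)  f = Eq.sym (sum-replicate-zero n)

  sum-mono-≤ : ∀ {n} {f g : Fin n → Carrier} → (∀ i → f i ≤ g i) → sum f ≤ sum g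
  sum-mono-≤ {ℕ.zero}  f≤g = refl
  sum-mono-≤ {ℕ.suc n} f≤g = +-mono-≤ (f≤g zero) (sum-mono-≤ λ i → f≤g (suc i))

  sum-nonneg : ∀ {n} {f : Fin n → Carrier} → (∀ i → 0# ≤ f i) → 0# ≤ sum f
  sum-nonneg {n} {f} 0≤f = begin
    0#                       ≈⟨ sum-replicate-zero n ⟨
    sum {n} (λ _ → 0#)       ≤⟨ sum-mono-≤ 0≤f ⟩
    sum f                    ∎

  *-nonneg : ∀ {x y} → 0# ≤ x → 0# ≤ y → 0# ≤ x * y
  *-nonneg {x} {y} 0≤x 0≤y = begin
    0#      ≈⟨ zeroˡ y ⟨
    0# * y  ≤⟨ *-monoʳ-≤ 0≤y 0≤x ⟩
    x * y   ∎

  -- Pairing (i , j) with (j , i) turns a bound on unordered pairs into a bound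
  -- on the double sums.
  sum²-mono-≤ : ∀ {n} (f g : Fin n → Fin n → Carrier) →
    (∀ i j → f i j + f j i ≤ g i j + g j i) →
    sum (λ i → sum (f i)) ≤ sum (λ i → sum (g i))
  sum²-mono-≤ f g f≤g = x+x≤y+y⇒x≤y (begin
    sum (λ i → sum (f i)) + sum (λ i → sum (f i))  ≈⟨ symmetrise f ⟨
    sum (λ i → sum λ j → f i j + f j i)            ≤⟨ sum-mono-≤ (λ i → sum-mono-≤ (f≤g i)) ⟩
    sum (λ i → sum λ j → g i j + g j i)            ≈⟨ symmetrise g ⟩
    sum (λ i → sum (g i)) + sum (λ i → sum (g i))  ∎)
    where
    symmetrise : ∀ h → sum (λ i → sum λ j → h i j + h j i) ≈
      sum (λ i → sum (h i)) + sum (λ i → sum (h i))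
    symmetrise h = begin-equality
      sum (λ i → sum λ j → h i j + h j i)
        ≈⟨ sum-cong-≋ (λ i → ∑-distrib-+ (h i) (λ j → h j i)) ⟩
      sum (λ i → sum (h i) + sum (λ j → h j i))
        ≈⟨ ∑-distrib-+ (λ i → sum (h i)) (λ i → sum λ j → h j i) ⟩
      sum (λ i → sum (h i)) + sum (λ i → sum λ j → h j i)
        ≈⟨ +-congˡ (∑-comm h) ⟨
      sum (λ i → sum (h i)) + sum (λ i → sum (h i))  ∎

  -- The cut of a bipartition and its comparison with revenue

  module Bipartition {n : ℕ} (w : Fin n → Fin n → Carrier)
           (w-sym : ∀ i j → w i j ≈ w j i) (0≤w : ∀ i j → 0# ≤ w i j)
           (A : Subset n)
           (inside≈0 : ∀ {i j} → i ∈ A → j ∈ A → w i j ≈ 0#)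
           (outside≈0 : ∀ {i j} → i ∈ ∁ A → j ∈ ∁ A → w i j ≈ 0#) where

    -- Only one orientation is kept, with the row outside `A` and the column inside, so `cut` counts
    -- each pair across the bipartition once, at the endpoint that pays under Influence-and-Exploit.
    crossing : Fin n → Fin n → Carrier
    crossing i j = [ i ∈? ∁ A ] [ j ∈? A ] w j i

    cut : Carrier
    cut = sum λ i → sum (crossing i)

    w-diag≈0 : ∀ i → w i i ≈ 0#
    w-diag≈0 i with ∈⊎∈∁ A i
    ... | inj₁ i∈A = inside≈0 i∈A i∈A
    ... | inj₂ i∈∁A = outside≈0 i∈∁A i∈∁A

    w-diag+ : ∀ i x → w i i + x ≈ x
    w-diag+ i x = Eq.trans (+-congʳ (w-diag≈0 i)) (+-identityˡ x)

    crossing-nonneg : ∀ i j → 0# ≤ crossing i j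
    crossing-nonneg i j = []-nonneg (i ∈? ∁ A) ([]-nonneg (j ∈? A) (0≤w j i))

    crossing-∁A-A : ∀ {i j} → i ∈ ∁ A → j ∈ A → crossing i j ≡ w j i
    crossing-∁A-A {i} {j} i∈∁A j∈A = ≡.trans (if-yes (i ∈? ∁ A) i∈∁A) (if-yes (j ∈? A) j∈A)

    -- A pair within one side has zero weight. For a pair across, one of the two orientations
    -- already carries the whole weight, up to `w-sym`.
    w≤crossing : ∀ i j → w j i ≤ crossing i j + crossing j i
    w≤crossing i j with ∈⊎∈∁ A i | ∈⊎∈∁ A j
    ... | inj₁ i∈A | inj₁ j∈A = begin
      w j i                        ≈⟨ inside≈0 j∈A i∈A ⟩
      0#                           ≈⟨ +-identityˡ 0# ⟨
      0# + 0#                      ≤⟨ +-mono-≤ (crossing-nonneg i j) (crossing-nonneg j i) ⟩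
      crossing i j + crossing j i  ∎
    ... | inj₂ i∈∁A | inj₂ j∈∁A = begin
      w j i                        ≈⟨ outside≈0 j∈∁A i∈∁A ⟩
      0#                           ≈⟨ +-identityˡ 0# ⟨
      0# + 0#                      ≤⟨ +-mono-≤ (crossing-nonneg i j) (crossing-nonneg j i) ⟩
      crossing i j + crossing j i  ∎
    ... | inj₂ i∈∁A | inj₁ j∈A = begin
      w j i                        ≡⟨ crossing-∁A-A i∈∁A j∈A ⟨
      crossing i j                 ≈⟨ +-identityʳ _ ⟨
      crossing i j + 0#            ≤⟨ +-mono-≤ refl (crossing-nonneg j i) ⟩
      crossing i j + crossing j i  ∎
    ... | inj₁ i∈A | inj₂ j∈∁A = begin
      w j i                        ≈⟨ w-sym j i ⟩
      w i j                        ≡⟨ crossing-∁A-A j∈∁A i∈A ⟨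
      crossing j i                 ≈⟨ +-identityˡ _ ⟨
      0# + crossing j i            ≤⟨ +-mono-≤ (crossing-nonneg i j) refl ⟩
      crossing i j + crossing j i  ∎

    -- The sum in `revenueIE` without its leading factor: `s` is the chance that one of two buyers
    -- precedes the other in random order, and `t` is the pricing probability.
    exploited : Carrier → Carrier → Carrier
    exploited s t = sum λ i → [ i ∈? ∁ A ] (w i i
      + sum (λ j → [ j ∈? A ] w j i)
      + sum (λ j → [ (j ∈? ∁ A) ×-dec ¬? (j Fin.≟ i) ] (s * (t * w j i))))

    -- Buyers outside `A` have no weight among themselves, so the terms containing `s` and `t`
    -- vanish, and what remains is the weight from `A`.
    exploited≈cut : ∀ s t → exploited s t ≈ cut
    exploited≈cut s t = sum-cong-≋ λ i → Eq.trans
      ([]-cong (i ∈? ∁ A) λ i∈∁A → Eq.trans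
        (+-cong (w-diag+ i _) (sum-zero λ j →
          []-zero ((j ∈? ∁ A) ×-dec ¬? (j Fin.≟ i)) λ (j∈∁A , _) → begin-equality
            s * (t * w j i)  ≈⟨ *-congˡ (*-congˡ (outside≈0 j∈∁A i∈∁A)) ⟩
            s * (t * 0#)     ≈⟨ *-congˡ (zeroʳ t) ⟩
            s * 0#           ≈⟨ zeroʳ s ⟩
            0#               ∎))
        (+-identityʳ _))
      ([]-sum (i ∈? ∁ A) λ j → [ j ∈? A ] w j i)

    module _ (π : Permutation′ n) where

      precedes? : ∀ j i → Dec ((π ⟨$⟩ʳ j) Fin.< (π ⟨$⟩ʳ i))
      precedes? j i = (π ⟨$⟩ʳ j) Fin.<? (π ⟨$⟩ʳ i)

      preceding : Fin n → Fin n → Carrier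
      preceding i j = [ precedes? j i ] w j i

      preceding≤w : ∀ i j → preceding i j + preceding j i ≤ w j i
      preceding≤w i j = []-disjoint-≤ (precedes? j i) (precedes? i j) Fin.<-asym
        (w-sym j i) (0≤w j i)

      -- No termwise comparison is possible: if `∁ A` comes first, weight sits at pairs where
      -- `crossing` is zero. Hence the passage through unordered pairs.
      preceding≤cut : sum (λ i → sum (preceding i)) ≤ cut
      preceding≤cut = sum²-mono-≤ preceding crossing λ i j →
        trans (preceding≤w i j) (w≤crossing i j)

      -- Here `q i` is p_i (1 - p_i) and `c` is a quarter. Each bracket is nonnegative, so `q i` can
      -- be raised to `c` and the constant pulled out; raising every `p j` to one then leaves the
      -- weight of preceding neighbours.
      revenue-sum≤cut : ∀ {c} (q p : Fin n → Carrier) → 0# ≤ c → (∀ i → q i ≤ c) →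
        (∀ j → 0# ≤ p j) → (∀ j → p j ≤ 1#) →
        sum (λ i → q i * (w i i + sum (λ j → [ precedes? j i ] (p j * w j i)))) ≤ c * cut
      revenue-sum≤cut {c} q p 0≤c q≤c 0≤p p≤1 = begin
        sum (λ i → q i * (w i i + influence i))
          ≤⟨ sum-mono-≤ (λ i → *-monoʳ-≤ (+-nonneg (0≤w i i) (0≤influence i)) (q≤c i)) ⟩
        sum (λ i → c * (w i i + influence i))
          ≈⟨ *-distribˡ-sum c (λ i → w i i + influence i) ⟨
        c * sum (λ i → w i i + influence i)
          ≈⟨ *-congˡ (sum-cong-≋ λ i → w-diag+ i (influence i)) ⟩
        c * sum influence
          ≤⟨ *-monoˡ-≤ (trans (sum-mono-≤ influence≤) preceding≤cut) ⟩
        c * cut ∎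
        where
        influence : Fin n → Carrier
        influence i = sum λ j → [ precedes? j i ] (p j * w j i)
        +-nonneg : ∀ {x y} → 0# ≤ x → 0# ≤ y → 0# ≤ x + y
        +-nonneg 0≤x 0≤y = trans (reflexive (Eq.sym (+-identityˡ 0#))) (+-mono-≤ 0≤x 0≤y)
        0≤influence : ∀ i → 0# ≤ influence i
        0≤influence i = sum-nonneg λ j →
          []-nonneg (precedes? j i) (*-nonneg (0≤p j) (0≤w j i))
        influence≤ : ∀ i → influence i ≤ sum (preceding i)
        influence≤ i = sum-mono-≤ λ j → []-mono-≤ (precedes? j i) (begin
          p j * w j i  ≤⟨ *-monoʳ-≤ (0≤w j i) (p≤1 j) ⟩
          1# * w j i   ≈⟨ *-identityˡ (w j i) ⟩
          w j i        ∎)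
        *-monoˡ-≤ : ∀ {x y} → x ≤ y → c * x ≤ c * y
        *-monoˡ-≤ {x} {y} x≤y = begin
          c * x  ≈⟨ *-comm c x ⟩
          x * c  ≤⟨ *-monoʳ-≤ 0≤c x≤y ⟩
          y * c  ≈⟨ *-comm y c ⟩
          c * y  ∎

      -- The equality holds row by row: a row in `A` vanishes on both sides, and a row outside
      -- collects its full weight from `A`, since all of `A` comes earlier and accepts with
      -- probability one.
      revenue-sum≈cut : ∀ {c} (q p : Fin n → Carrier) →
        (∀ {i} → i ∈ A → q i ≈ 0#) → (∀ {i} → i ∈ ∁ A → q i ≈ c) →
        (∀ {j} → j ∈ A → p j ≈ 1#) →
        (∀ {j i} → j ∈ A → i ∈ ∁ A → (π ⟨$⟩ʳ j) Fin.< (π ⟨$⟩ʳ i)) →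
        sum (λ i → q i * (w i i + sum (λ j → [ precedes? j i ] (p j * w j i)))) ≈ c * cut
      revenue-sum≈cut {c} q p q≈0 q≈c p≈1 A-first = Eq.trans (sum-cong-≋ row)
        (Eq.sym (*-distribˡ-sum c λ i → sum (crossing i)))
        where
        influence : Fin n → Carrier
        influence i = sum λ j → [ precedes? j i ] (p j * w j i)

        entry : ∀ {i} → i ∈ ∁ A → ∀ j → [ precedes? j i ] (p j * w j i) ≈ crossing i j
        entry {i} i∈∁A j with ∈⊎∈∁ A j
        ... | inj₁ j∈A = begin-equality
          [ precedes? j i ] (p j * w j i)  ≡⟨ if-yes (precedes? j i) (A-first j∈A i∈∁A) ⟩
          p j * w j i                      ≈⟨ *-congʳ (p≈1 j∈A) ⟩
          1# * w j i                       ≈⟨ *-identityˡ (w j i) ⟩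
          w j i                            ≡⟨ crossing-∁A-A i∈∁A j∈A ⟨
          crossing i j                     ∎
        -- Both sides are zero whether or not `j` comes before `i`, so the order among the buyers
        -- outside `A` is immaterial.
        ... | inj₂ j∈∁A = begin-equality
          [ precedes? j i ] (p j * w j i)  ≈⟨ []-zero (precedes? j i) (λ _ → Eq.trans
                                                (*-congˡ (outside≈0 j∈∁A i∈∁A))
                                                (zeroʳ (p j))) ⟩
          0#                               ≈⟨ []-zero (i ∈? ∁ A) (λ _ →
                                                []-zero (j ∈? A) λ j∈A →
                                                  contradiction j∈A (x∈∁p⇒x∉p j∈∁A)) ⟨
          crossing i j                     ∎

        row : ∀ i → q i * (w i i + influence i) ≈ c * sum (crossing i)
        row i with ∈⊎∈∁ A i
        ... | inj₁ i∈A = begin-equality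
          q i * (w i i + influence i)  ≈⟨ *-congʳ (q≈0 i∈A) ⟩
          0# * (w i i + influence i)   ≈⟨ zeroˡ _ ⟩
          0#                           ≈⟨ zeroʳ c ⟨
          c * 0#                       ≈⟨ *-congˡ (sum-zero {f = crossing i} λ j → []-zero (i ∈? ∁ A)
                                            λ i∈∁A → contradiction i∈A (x∈∁p⇒x∉p i∈∁A)) ⟨
          c * sum (crossing i)         ∎
        ... | inj₂ i∈∁A = *-cong (q≈c i∈∁A)
          (Eq.trans (w-diag+ i (influence i)) (sum-cong-≋ (entry i∈∁A)))

-- Prepending a buyer in A to the others puts it first; prepending one outside A
-- puts it last.
subset-first : ∀ {n} (A : Subset n) →
  ∃ λ (π : Permutation′ n) → ∀ {j i} → j ∈ A → i ∈ ∁ A → (π ⟨$⟩ʳ j) Fin.< (π ⟨$⟩ʳ i)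
subset-first [] = Permutation.id , λ ()
subset-first (inside ∷ A) with subset-first A
... | π , A-first = insert zero zero π , first
  where
  first : ∀ {j i} → j ∈ inside ∷ A → i ∈ ∁ (inside ∷ A) →
    (insert zero zero π ⟨$⟩ʳ j) Fin.< (insert zero zero π ⟨$⟩ʳ i)
  first {zero}  {suc i} _           _            = z<s
  first {suc j} {suc i} (there j∈A) (there i∈∁A) = s<s (A-first j∈A i∈∁A)
subset-first {ℕ.suc n} (outside ∷ A) with subset-first A
... | π , A-first = insert zero (fromℕ n) π , first
  where
  first : ∀ {j i} → j ∈ outside ∷ A → i ∈ ∁ (outside ∷ A) →
    (insert zero (fromℕ n) π ⟨$⟩ʳ j) Fin.< (insert zero (fromℕ n) π ⟨$⟩ʳ i)
  -- The new buyer gets the greatest position `fromℕ n`; every other position is a value of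
  -- `punchIn (fromℕ n)`, which avoids it.
  first {suc j} {zero} _ _ =
    Fin.≤∧≢⇒< (Fin.≤fromℕ _) (Fin.punchInᵢ≢i (fromℕ n) (π ⟨$⟩ʳ j))
  first {suc j} {suc i} (there j∈A) (there i∈∁A) = ℕ.≰⇒> λ ↑i≤↑j →
    ℕ.<⇒≱ (A-first j∈A i∈∁A)
      (Fin.punchIn-cancel-≤ (fromℕ n) (π ⟨$⟩ʳ i) (π ⟨$⟩ʳ j) ↑i≤↑j)

-- Rational inequalities

open import Defs

private
  -- Turns an inequality into an explicit nonnegative slack `r` and a ring identity, which the
  -- solver can check.
  ≤-by : ∀ {p q r} → 0ℚ ℚ.≤ r → p ℚ.+ r ≡ q → p ℚ.≤ q
  ≤-by {p} 0≤r ≡.refl =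
    ℚ.≤-trans (ℚ.≤-reflexive (≡.sym (ℚ.+-identityʳ p))) (ℚ.+-monoʳ-≤ p 0≤r)

  0≤q-p : ∀ {p q} → p ℚ.≤ q → 0ℚ ℚ.≤ q ℚ.- p
  0≤q-p {p} p≤q =
    ℚ.≤-trans (ℚ.≤-reflexive (≡.sym (ℚ.+-inverseʳ p))) (ℚ.+-monoˡ-≤ (ℚ.- p) p≤q)

  0≤+ : ∀ {p q} → 0ℚ ℚ.≤ p → 0ℚ ℚ.≤ q → 0ℚ ℚ.≤ p ℚ.+ q
  0≤+ = ℚ.+-mono-≤

  0≤* : ∀ {p q} → 0ℚ ℚ.≤ p → 0ℚ ℚ.≤ q → 0ℚ ℚ.≤ p ℚ.* q
  0≤* {p} {q} 0≤p 0≤q = ℚ.nonNegative⁻¹ _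
    {{ℚ.nonNeg*nonNeg⇒nonNeg p {{ℚ.nonNegative 0≤p}} q {{ℚ.nonNegative 0≤q}}}}

  0≤p² : ∀ p → 0ℚ ℚ.≤ p ℚ.* p
  0≤p² p with ℚ.≤-total 0ℚ p
  ... | inj₁ 0≤p = 0≤* 0≤p 0≤p
  ... | inj₂ p≤0 = ℚ.≤-trans (0≤* 0≤-p 0≤-p) (ℚ.≤-reflexive (square-neg p))
    where
    open +-*-Solver
    0≤-p : 0ℚ ℚ.≤ ℚ.- p
    0≤-p = ℚ.neg-antimono-≤ p≤0
    square-neg : ∀ p → (ℚ.- p) ℚ.* (ℚ.- p) ≡ p ℚ.* p
    square-neg = solve 1 (λ p → (:- p) :* (:- p) := p :* p) ≡.refl

  p≤∣p∣ : ∀ p → p ℚ.≤ ℚ.∣ p ∣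
  p≤∣p∣ p with ℚ.≤-total 0ℚ p
  ... | inj₁ 0≤p = ℚ.≤-reflexive (≡.sym (ℚ.0≤p⇒∣p∣≡p 0≤p))
  ... | inj₂ p≤0 = ℚ.≤-trans p≤0 (ℚ.0≤∣p∣ p)

  ∣p-q∣≤r⇒p≤q+r : ∀ {p q r} → ℚ.∣ p ℚ.- q ∣ ℚ.≤ r → p ℚ.≤ q ℚ.+ r
  ∣p-q∣≤r⇒p≤q+r {p} {q} {r} d = ≤-by (0≤q-p (ℚ.≤-trans (p≤∣p∣ (p ℚ.- q)) d)) (split p q r)
    where
    open +-*-Solver
    split : ∀ p q r → p ℚ.+ (r ℚ.- (p ℚ.- q)) ≡ q ℚ.+ r
    split = solve 3 (λ p q r → p :+ (r :- (p :- q)) := q :+ r) ≡.refl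

  p≤q+r∧q≤p+r⇒∣p-q∣≤r : ∀ {p q r} → p ℚ.≤ q ℚ.+ r → q ℚ.≤ p ℚ.+ r →
    ℚ.∣ p ℚ.- q ∣ ℚ.≤ r
  p≤q+r∧q≤p+r⇒∣p-q∣≤r {p} {q} {r} p≤ q≤ with ℚ.∣p∣≡p∨∣p∣≡-p (p ℚ.- q)
  ... | inj₁ eq rewrite eq = ≤-by (0≤q-p p≤) (split p q r)
    where
    open +-*-Solver
    split : ∀ p q r → (p ℚ.- q) ℚ.+ (q ℚ.+ r ℚ.- p) ≡ r
    split = solve 3 (λ p q r → (p :- q) :+ (q :+ r :- p) := r) ≡.refl
  ... | inj₂ eq rewrite eq = ≤-by (0≤q-p q≤) (split p q r)
    where
    open +-*-Solver
    split : ∀ p q r → (ℚ.- (p ℚ.- q)) ℚ.+ (p ℚ.+ r ℚ.- q) ≡ r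
    split = solve 3 (λ p q r → (:- (p :- q)) :+ (p :+ r :- q) := r) ≡.refl

  -- The slack is (p - 1/2)². The bound holds for every rational, so it applies termwise to a
  -- sequence representing a price, even where its terms leave [1/2, 1].
  p*[1-p]≤½*[1-½] : ∀ p → p ℚ.* (ℚ.1ℚ ℚ.- p) ℚ.≤ ℚ.½ ℚ.* (ℚ.1ℚ ℚ.- ℚ.½)
  p*[1-p]≤½*[1-½] p = ≤-by (0≤p² (p ℚ.- ℚ.½)) (complete-square p)
    where
    open +-*-Solver
    complete-square : ∀ p →
      p ℚ.* (ℚ.1ℚ ℚ.- p) ℚ.+ (p ℚ.- ℚ.½) ℚ.* (p ℚ.- ℚ.½) ≡ ℚ.½ ℚ.* (ℚ.1ℚ ℚ.- ℚ.½)
    complete-square = solve 1 (λ p →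
      p :* (con ℚ.1ℚ :- p) :+ (p :- con ℚ.½) :* (p :- con ℚ.½)
        := con (ℚ.½ ℚ.* (ℚ.1ℚ ℚ.- ℚ.½))) ≡.refl

  -- Terms of a sequence representing a nonnegative real may dip to -δ. If p ≥ 0, then p q ≥ -p δ ≥
  -- -B δ; if p ≤ 0, then p q ≥ p C ≥ -C δ.
  *-almost-nonneg : ∀ {p q B C δ} → ℚ.∣ p ∣ ℚ.≤ B → ℚ.∣ q ∣ ℚ.≤ C → 0ℚ ℚ.≤ δ →
    0ℚ ℚ.≤ p ℚ.+ δ → 0ℚ ℚ.≤ q ℚ.+ δ → 0ℚ ℚ.≤ p ℚ.* q ℚ.+ (B ℚ.+ C) ℚ.* δ
  *-almost-nonneg {p} {q} {B} {C} {δ} ∣p∣≤B ∣q∣≤C 0≤δ 0≤p+δ 0≤q+δ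
    with ℚ.≤-total 0ℚ p
  ... | inj₁ 0≤p = ℚ.≤-trans
      (0≤+ (0≤* 0≤p 0≤q+δ) (0≤+ (0≤* (0≤q-p p≤B) 0≤δ) (0≤* 0≤C 0≤δ)))
      (ℚ.≤-reflexive (expand p q B C δ))
    where
    open +-*-Solver
    p≤B = ℚ.≤-trans (p≤∣p∣ p) ∣p∣≤B
    0≤C = ℚ.≤-trans (ℚ.0≤∣p∣ q) ∣q∣≤C
    expand : ∀ p q B C δ →
      p ℚ.* (q ℚ.+ δ) ℚ.+ ((B ℚ.- p) ℚ.* δ ℚ.+ C ℚ.* δ) ≡ p ℚ.* q ℚ.+ (B ℚ.+ C) ℚ.* δ
    expand = solve 5 (λ p q B C δ →
      p :* (q :+ δ) :+ ((B :- p) :* δ :+ C :* δ) := p :* q :+ (B :+ C) :* δ) ≡.refl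
  ... | inj₂ p≤0 = ℚ.≤-trans
      (0≤+ (0≤* (ℚ.neg-antimono-≤ p≤0) (0≤q-p q≤C)) (0≤+ (0≤* 0≤C 0≤p+δ) (0≤* 0≤B 0≤δ)))
      (ℚ.≤-reflexive (expand p q B C δ))
    where
    open +-*-Solver
    q≤C = ℚ.≤-trans (p≤∣p∣ q) ∣q∣≤C
    0≤B = ℚ.≤-trans (ℚ.0≤∣p∣ p) ∣p∣≤B
    0≤C = ℚ.≤-trans (ℚ.0≤∣p∣ q) ∣q∣≤C
    expand : ∀ p q B C δ →
      (ℚ.- p) ℚ.* (C ℚ.- q) ℚ.+ (C ℚ.* (p ℚ.+ δ) ℚ.+ B ℚ.* δ) ≡ p ℚ.* q ℚ.+ (B ℚ.+ C) ℚ.* δ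
    expand = solve 5 (λ p q B C δ →
      (:- p) :* (C :- q) :+ (C :* (p :+ δ) :+ B :* δ) := p :* q :+ (B :+ C) :* δ) ≡.refl

-- The ordered semiring of real numbers. The relations _≃_ and _≤_ unfold to
-- statements about seq alone, so the real arguments of a lemma cannot be
-- inferred and are given explicitly.

eventually-zip : {P Q R : ℕ → Set} → (∀ n → P n → Q n → R n) →
  Eventually P → Eventually Q → Eventually R
eventually-zip f (M , p) (N , q) = M ⊔ N , λ n ≤n →
  f n (p n (ℕ.m⊔n≤o⇒m≤o M N ≤n)) (q n (ℕ.m⊔n≤o⇒n≤o M N ≤n))

eventually-map : {P Q : ℕ → Set} → (∀ n → P n → Q n) → Eventually P → Eventually Q
eventually-map f (N , p) = N , λ n ≤n → f n (p n ≤n)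

pointwise-≤ : ∀ {x y} → (∀ n → seq x n ℚ.≤ seq y n) → x ≤ y
pointwise-≤ {x} {y} h ε 0<ε = 0 , λ n _ →
  ≤-by (0≤+ (0≤q-p (h n)) (ℚ.<⇒≤ 0<ε)) (split (seq x n) (seq y n) ε)
  where
  open +-*-Solver
  split : ∀ p q ε → p ℚ.+ (q ℚ.- p ℚ.+ ε) ≡ q ℚ.+ ε
  split = solve 3 (λ p q ε → p :+ (q :- p :+ ε) := q :+ ε) ≡.refl

≃⇒≤ : ∀ {x y} → x ≃ y → x ≤ y
≃⇒≤ x≃y ε 0<ε = eventually-map (λ _ → ∣p-q∣≤r⇒p≤q+r) (x≃y ε 0<ε)

≤-antisym : ∀ {x y} → x ≤ y → y ≤ x → x ≃ y
≤-antisym x≤y y≤x ε 0<ε =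
  eventually-zip (λ _ → p≤q+r∧q≤p+r⇒∣p-q∣≤r) (x≤y ε 0<ε) (y≤x ε 0<ε)

≃-sym : ∀ {x y} → x ≃ y → y ≃ x
≃-sym {x} {y} x≃y ε 0<ε = eventually-map
  (λ n d → ℚ.≤-trans (ℚ.≤-reflexive (flip (seq x n) (seq y n))) d) (x≃y ε 0<ε)
  where
  open +-*-Solver
  negated : ∀ p q → q ℚ.- p ≡ ℚ.- (p ℚ.- q)
  negated = solve 2 (λ p q → q :- p := :- (p :- q)) ≡.refl
  flip : ∀ p q → ℚ.∣ q ℚ.- p ∣ ≡ ℚ.∣ p ℚ.- q ∣
  flip p q = ≡.trans (cong ℚ.∣_∣ (negated p q)) (ℚ.∣-p∣≡∣p∣ (p ℚ.- q))

≤-trans : ∀ {x y z} → x ≤ y → y ≤ z → x ≤ z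
≤-trans {x} {y} {z} x≤y y≤z ε 0<ε =
  eventually-zip (λ n p≤q q≤r → ℚ.≤-trans p≤q
      (ℚ.≤-trans (ℚ.+-monoˡ-≤ (ε ℚ.* ℚ.½) q≤r) (ℚ.≤-reflexive (halves (seq z n)))))
    (x≤y _ (½-pos 0<ε)) (y≤z _ (½-pos 0<ε))
  where
  halves : ∀ r → r ℚ.+ ε ℚ.* ℚ.½ ℚ.+ ε ℚ.* ℚ.½ ≡ r ℚ.+ ε
  halves r = ≡.trans (ℚ.+-assoc r _ _) (cong (r ℚ.+_) (½-split ε))

pointwise-≃ : ∀ {x y} → (∀ n → seq x n ≡ seq y n) → x ≃ y
pointwise-≃ {x} {y} h = ≤-antisym {x} {y}
  (pointwise-≤ {x} {y} λ n → ℚ.≤-reflexive (h n))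
  (pointwise-≤ {y} {x} λ n → ℚ.≤-reflexive (≡.sym (h n)))

+-mono-≤ : ∀ {x y u v} → x ≤ y → u ≤ v → x + u ≤ y + v
+-mono-≤ {x} {y} {u} {v} x≤y u≤v ε 0<ε =
  eventually-zip (λ n p≤q r≤s → ℚ.≤-trans (ℚ.+-mono-≤ p≤q r≤s)
      (ℚ.≤-reflexive (≡.trans (regroup (seq y n) (seq v n) (ε ℚ.* ℚ.½))
        (cong (seq y n ℚ.+ seq v n ℚ.+_) (½-split ε)))))
    (x≤y _ (½-pos 0<ε)) (u≤v _ (½-pos 0<ε))
  where
  open +-*-Solver
  regroup : ∀ q s h → (q ℚ.+ h) ℚ.+ (s ℚ.+ h) ≡ q ℚ.+ s ℚ.+ (h ℚ.+ h)
  regroup = solve 3 (λ q s h → (q :+ h) :+ (s :+ h) := q :+ s :+ (h :+ h)) ≡.refl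

*-nonneg : ∀ {x y} → 0ℝ ≤ x → 0ℝ ≤ y → 0ℝ ≤ x * y
*-nonneg {x} {y} 0≤x 0≤y ε 0<ε =
  let B , 0<B , x-bounded = cauchy-bounded {seq x} (cauchy x)
      C , 0<C , y-bounded = cauchy-bounded {seq y} (cauchy y)
      -- With this δ the total error (B + C) δ of `*-almost-nonneg` is exactly ε.
      δ , 0<δ , [B+C]δ≡ε = divide {B ℚ.+ C} (ℚ.+-mono-< 0<B 0<C) 0<ε
  in eventually-zip
    (λ n (∣p∣≤B , 0≤p+δ) (∣q∣≤C , 0≤q+δ) → subst (λ r → 0ℚ ℚ.≤ seq x n ℚ.* seq y n ℚ.+ r) [B+C]δ≡ε
      (*-almost-nonneg {seq x n} {seq y n} ∣p∣≤B ∣q∣≤C (ℚ.<⇒≤ 0<δ) 0≤p+δ 0≤q+δ))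
    (eventually-zip (λ _ → _,_) x-bounded (0≤x δ 0<δ))
    (eventually-zip (λ _ → _,_) y-bounded (0≤y δ 0<δ))

-- Reduces to `*-nonneg` by writing y z = x z + (y - x) z.
*-monoʳ-≤ : ∀ {x y z} → 0ℝ ≤ z → x ≤ y → x * z ≤ y * z
*-monoʳ-≤ {x} {y} {z} 0≤z x≤y =
  ≤-trans {x * z} {x * z + 0ℝ} {y * z}
    (pointwise-≤ {x * z} {x * z + 0ℝ} λ n → ℚ.≤-reflexive (≡.sym (ℚ.+-identityʳ _)))
    (≤-trans {x * z + 0ℝ} {x * z + (y - x) * z} {y * z}
      (+-mono-≤ {x * z} {x * z} {0ℝ} {(y - x) * z}
        (pointwise-≤ {x * z} {x * z} λ _ → ℚ.≤-refl)
        (*-nonneg {y - x} {z} 0≤y-x 0≤z))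
      (pointwise-≤ {x * z + (y - x) * z} {y * z} λ n →
        ℚ.≤-reflexive (cancel (seq x n) (seq y n) (seq z n))))
  where
  open +-*-Solver
  cancel : ∀ p q r → p ℚ.* r ℚ.+ (q ℚ.- p) ℚ.* r ≡ q ℚ.* r
  cancel = solve 3 (λ p q r → p :* r :+ (q :- p) :* r := q :* r) ≡.refl
  swap : ∀ p q ε → q ℚ.+ ε ℚ.- p ≡ q ℚ.- p ℚ.+ ε
  swap = solve 3 (λ p q ε → q :+ ε :- p := q :- p :+ ε) ≡.refl
  0≤y-x : 0ℝ ≤ y - x
  0≤y-x ε 0<ε = eventually-map
    (λ n p≤q → subst (0ℚ ℚ.≤_) (swap (seq x n) (seq y n) ε) (0≤q-p p≤q)) (x≤y ε 0<ε)

*-cong : ∀ {x y u v} → x ≃ y → u ≃ v → x * u ≃ y * v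
*-cong {x} {y} {u} {v} x≃y u≃v ε 0<ε =
  -- The difference x u - y v is split as x (u - v) + v (x - y), so the bounds to supply are those
  -- on x and v.
  let B , 0<B , x-bounded = cauchy-bounded {seq x} (cauchy x)
      C , 0<C , v-bounded = cauchy-bounded {seq v} (cauchy v)
      δ , 0<δ , [B+C]δ≡ε = divide {B ℚ.+ C} (ℚ.+-mono-< 0<B 0<C) 0<ε
  in eventually-zip
    (λ n (∣a∣≤B , ∣a-c∣≤δ) (∣d∣≤C , ∣b-d∣≤δ) → ℚ.≤-trans
      (*-diff-bound (seq x n) (seq u n) (seq y n) (seq v n) B C δ (ℚ.<⇒≤ 0<δ)
        ∣a∣≤B ∣d∣≤C ∣b-d∣≤δ ∣a-c∣≤δ)
      (ℚ.≤-reflexive [B+C]δ≡ε))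
    (eventually-zip (λ _ → _,_) x-bounded (x≃y δ 0<δ))
    (eventually-zip (λ _ → _,_) v-bounded (u≃v δ 0<δ))

-- Turns the absence of an edge into an upper bound on its weight, constructively. One term taken
-- late enough is compared with ε/2, a decidable question on rationals: if it is at most ε/2, all
-- later terms are at most ε; otherwise its excess over ε/2 is a positive lower bound for all later
-- terms, contradicting the hypothesis.
≮0⇒≤0 : ∀ {x} → ¬ (0ℝ < x) → x ≤ 0ℝ
≮0⇒≤0 {x} 0≮x ε 0<ε with cauchy x (ε ℚ.* ℚ.½) (½-pos 0<ε)
... | N , close with seq x N ℚ.≤? ε ℚ.* ℚ.½
...   | yes small = N , λ n N≤n → begin
        seq x n                    ≤⟨ ∣p-q∣≤r⇒p≤q+r (close n N N≤n ℕ.≤-refl) ⟩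
        seq x N ℚ.+ ε ℚ.* ℚ.½      ≤⟨ ℚ.+-monoˡ-≤ (ε ℚ.* ℚ.½) small ⟩
        ε ℚ.* ℚ.½ ℚ.+ ε ℚ.* ℚ.½    ≡⟨ ½-split ε ⟩
        ε                          ≡⟨ ℚ.+-identityˡ ε ⟨
        0ℚ ℚ.+ ε                   ∎
  where open ℚ.≤-Reasoning
...   | no large = contradiction (η , 0<η , N , η≤x) 0≮x
  where
  open +-*-Solver
  η : ℚ
  η = seq x N ℚ.- ε ℚ.* ℚ.½
  0<η : 0ℚ ℚ.< η
  0<η = subst (ℚ._< η) (ℚ.+-inverseʳ (ε ℚ.* ℚ.½))
    (ℚ.+-monoˡ-< (ℚ.- (ε ℚ.* ℚ.½)) (ℚ.≰⇒> large))
  cancel : ∀ a b d → 0ℚ ℚ.+ (a ℚ.- d) ℚ.+ (b ℚ.+ d ℚ.- a) ≡ b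
  cancel = solve 3 (λ a b d → con 0ℚ :+ (a :- d) :+ (b :+ d :- a) := b) ≡.refl
  η≤x : ∀ n → N ℕ.≤ n → 0ℚ ℚ.+ η ℚ.≤ seq x n
  η≤x n N≤n = ≤-by (0≤q-p (∣p-q∣≤r⇒p≤q+r {seq x N} {seq x n} (close N n ℕ.≤-refl N≤n)))
    (cancel (seq x N) (seq x n) (ε ℚ.* ℚ.½))

≤-isPartialOrder : IsPartialOrder _≃_ _≤_
≤-isPartialOrder = record
  { isPreorder = record
    { isEquivalence = record
      { refl  = λ {x} → ≃-refl {x}
      ; sym   = λ {x} {y} → ≃-sym {x} {y}
      ; trans = λ {x} {y} {z} x≃y y≃z → ≤-antisym {x} {z}
          (≤-trans {x} {y} {z} (≃⇒≤ {x} {y} x≃y) (≃⇒≤ {y} {z} y≃z))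
          (≤-trans {z} {y} {x} (≃⇒≤ {z} {y} (≃-sym {y} {z} y≃z))
                               (≃⇒≤ {y} {x} (≃-sym {x} {y} x≃y)))
      }
    ; reflexive = λ {x} {y} → ≃⇒≤ {x} {y}
    ; trans     = λ {x} {y} {z} → ≤-trans {x} {y} {z}
    }
  ; antisym = λ {x} {y} → ≤-antisym {x} {y}
  }
  where
  ≃-refl : ∀ {x} → x ≃ x
  ≃-refl {x} = pointwise-≃ {x} {x} λ _ → ≡.refl

private module ℝ≤ = IsPartialOrder ≤-isPartialOrder

+-cong : ∀ {x y u v} → x ≃ y → u ≃ v → x + u ≃ y + v
+-cong {x} {y} {u} {v} x≃y u≃v = ≤-antisym {x + u} {y + v}
  (+-mono-≤ {x} {y} {u} {v} (≃⇒≤ {x} {y} x≃y) (≃⇒≤ {u} {v} u≃v))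
  (+-mono-≤ {y} {x} {v} {u} (≃⇒≤ {y} {x} (≃-sym {x} {y} x≃y))
                            (≃⇒≤ {v} {u} (≃-sym {u} {v} u≃v)))

-- The algebraic laws hold term by term on sequences; the analytic content lies in the two
-- congruences.
ℝ-commutativeSemiring : CommutativeSemiring 0ℓ 0ℓ
ℝ-commutativeSemiring = record
  { Carrier = ℝ
  ; _≈_ = _≃_
  ; _+_ = _+_
  ; _*_ = _*_
  ; 0#  = 0ℝ
  ; 1#  = 1ℝ
  ; isCommutativeSemiring = isCommutativeSemiringˡ record
    { +-isCommutativeMonoid = isCommutativeMonoidˡ record
      { isSemigroup = record
        { isMagma = record
          { isEquivalence = ℝ≤.isEquivalence
          ; ∙-cong        = λ {x} {y} {u} {v} → +-cong {x} {y} {u} {v}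
          }
        ; assoc = λ x y z → pointwise-≃ {(x + y) + z} {x + (y + z)}
            λ n → ℚ.+-assoc (seq x n) (seq y n) (seq z n)
        }
      ; identityˡ = λ x → pointwise-≃ {0ℝ + x} {x} λ n → ℚ.+-identityˡ (seq x n)
      ; comm      = λ x y → pointwise-≃ {x + y} {y + x} λ n → ℚ.+-comm (seq x n) (seq y n)
      }
    ; *-isCommutativeMonoid = isCommutativeMonoidˡ record
      { isSemigroup = record
        { isMagma = record
          { isEquivalence = ℝ≤.isEquivalence
          ; ∙-cong        = λ {x} {y} {u} {v} → *-cong {x} {y} {u} {v}
          }
        ; assoc = λ x y z → pointwise-≃ {(x * y) * z} {x * (y * z)}
            λ n → ℚ.*-assoc (seq x n) (seq y n) (seq z n)
        }
      ; identityˡ = λ x → pointwise-≃ {1ℝ * x} {x} λ n → ℚ.*-identityˡ (seq x n)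
      ; comm      = λ x y → pointwise-≃ {x * y} {y * x} λ n → ℚ.*-comm (seq x n) (seq y n)
      }
    ; distribʳ = λ x y z → pointwise-≃ {(y + z) * x} {y * x + z * x}
        λ n → ℚ.*-distribʳ-+ (seq x n) (seq y n) (seq z n)
    ; zeroˡ = λ x → pointwise-≃ {0ℝ * x} {0ℝ} λ n → ℚ.*-zeroˡ (seq x n)
    }
  }

x+x≤y+y⇒x≤y : ∀ {x y} → x + x ≤ y + y → x ≤ y
x+x≤y+y⇒x≤y {x} {y} 2x≤2y =
  ≤-trans {x} {(x + x) * ½} {y} (≃⇒≤ {x} {(x + x) * ½} (≃-sym {(x + x) * ½} {x} (half x)))
    (≤-trans {(x + x) * ½} {(y + y) * ½} {y}
      (*-monoʳ-≤ {x + x} {y + y} {½} 0≤½ 2x≤2y)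
      (≃⇒≤ {(y + y) * ½} {y} (half y)))
  where
  0≤½ : 0ℝ ≤ ½
  0≤½ = pointwise-≤ {0ℝ} {½} λ _ → ℚ.nonNegative⁻¹ ℚ.½
  half : ∀ z → (z + z) * ½ ≃ z
  half z = pointwise-≃ {(z + z) * ½} {z} λ n →
    ≡.trans (ℚ.*-distribʳ-+ ℚ.½ (seq z n) (seq z n)) (½-split (seq z n))

ℝ-orderedSemiring : OrderedSemiring
ℝ-orderedSemiring = record
  { commutativeSemiring = ℝ-commutativeSemiring
  ; _≤_            = _≤_
  ; isPartialOrder = ≤-isPartialOrder
  ; +-mono-≤       = λ {x} {y} {u} {v} → +-mono-≤ {x} {y} {u} {v}
  ; *-monoʳ-≤      = λ {x} {y} {z} → *-monoʳ-≤ {x} {y} {z}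
  ; x+x≤y+y⇒x≤y    = λ {x} {y} → x+x≤y+y⇒x≤y {x} {y}
  }

-- Optimality of Influence-and-Exploit on bipartite networks

module _ {n : ℕ} (G : Network n) where
  open Network G

  -- `Edge` relates distinct buyers only, so the diagonal comes from its own hypothesis; elsewhere a
  -- weight that is nonnegative and not positive is zero.
  independent⇒w≃0 : (∀ i → w i i ≃ 0ℝ) → ∀ {S} → Independent S →
    ∀ {i j} → i ∈ S → j ∈ S → w i j ≃ 0ℝ
  independent⇒w≃0 w-diag ind {i} {j} i∈S j∈S with i Fin.≟ j
  ... | yes ≡.refl = w-diag i
  ... | no i≢j     = ≤-antisym {w i j} {0ℝ}
    (≮0⇒≤0 {w i j} λ 0<w → ind i∈S j∈S (i≢j , 0<w)) (w-nonneg i j)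

module _ {n : ℕ} (A : Subset n) where

  -- Pricing probability one models a free product: the buyer surely accepts, and the factor p (1 -
  -- p) makes the revenue zero.
  price : Fin n → ℝ
  price i = if does (i ∈? A) then 1ℝ else ½

  price-∈ : ∀ {i} → i ∈ A → price i ≡ 1ℝ
  price-∈ {i} = if-yes (i ∈? A)

  price-∉ : ∀ {i} → i ∉ A → price i ≡ ½
  price-∉ {i} = if-no (i ∈? A)

  -- A strategy has one fixed order, so this replaces the random order outside `A` by a particular
  -- one; on a bipartite network the revenue is the same.
  influenceAndExploit : Strategy n
  influenceAndExploit = record
    { π   = proj₁ (subset-first A)
    ; p   = price
    ; ½≤p = ½≤price
    ; p≤1 = price≤1
    }
    where
    ½≤1 : ½ ≤ 1ℝ
    -- The maximum of 1/2 and 1 computes to 1.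
    ½≤1 = pointwise-≤ {½} {1ℝ} λ _ → ℚ.p≤p⊔q ℚ.½ ℚ.1ℚ
    ½≤price : ∀ i → ½ ≤ price i
    ½≤price i with i ∈? A
    ... | yes _ = ½≤1
    ... | no _  = ℝ≤.refl {½}
    price≤1 : ∀ i → price i ≤ 1ℝ
    price≤1 i with i ∈? A
    ... | yes _ = ℝ≤.refl {1ℝ}
    ... | no _  = ½≤1

proposition3 : (n : ℕ) (G : Network n) →
    Network.Bipartite G →
    (∀ i → Network.w G i i ≃ 0ℝ) →
    (A : Subset n) → Network.IsBipartition G A →
    IsMaximumRevenue G (revenueIE G A ½)
proposition3 n G _ w-diag A (A-ind , ∁A-ind) =
  (influenceAndExploit A , optimal) , bound
  where
  open Network G

  inside≃0 : ∀ {i j} → i ∈ A → j ∈ A → w i j ≃ 0ℝ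
  inside≃0 = independent⇒w≃0 G w-diag A-ind

  outside≃0 : ∀ {i j} → i ∈ ∁ A → j ∈ ∁ A → w i j ≃ 0ℝ
  outside≃0 = independent⇒w≃0 G w-diag ∁A-ind

  open WeightedCut.Bipartition ℝ-orderedSemiring w w-sym w-nonneg A inside≃0 outside≃0

  ¼ : ℝ
  ¼ = ½ * (1ℝ - ½)

  IE≃¼cut : revenueIE G A ½ ≃ ¼ * cut
  -- `revenueIE G A ½` unfolds to `¼ * exploited ½ ½`, one half coming from the random order and the
  -- other from the price.
  IE≃¼cut = *-cong {¼} {¼} {exploited ½ ½} {cut} (ℝ≤.Eq.refl {¼}) (exploited≈cut ½ ½)

  ¼cut≃IE : ¼ * cut ≃ revenueIE G A ½
  ¼cut≃IE = ≃-sym {revenueIE G A ½} {¼ * cut} IE≃¼cut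

  optimal : revenue G (influenceAndExploit A) ≃ revenueIE G A ½
  optimal = ℝ≤.Eq.trans {revenue G (influenceAndExploit A)} {¼ * cut} {revenueIE G A ½}
    (revenue-sum≈cut (proj₁ (subset-first A)) {¼}
      (λ i → price A i * (1ℝ - price A i)) (price A)
      q≃0 q≃¼ p≃1 (proj₂ (subset-first A)))
    ¼cut≃IE
    where
    p≃1 : ∀ {j} → j ∈ A → price A j ≃ 1ℝ
    p≃1 j∈A rewrite price-∈ A j∈A = ℝ≤.Eq.refl {1ℝ}
    q≃0 : ∀ {i} → i ∈ A → price A i * (1ℝ - price A i) ≃ 0ℝ
    q≃0 i∈A rewrite price-∈ A i∈A = pointwise-≃ {1ℝ * (1ℝ - 1ℝ)} {0ℝ} λ _ → ≡.refl
    q≃¼ : ∀ {i} → i ∈ ∁ A → price A i * (1ℝ - price A i) ≃ ¼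
    q≃¼ i∈∁A rewrite price-∉ A (x∈∁p⇒x∉p i∈∁A) = ℝ≤.Eq.refl {¼}

  bound : ∀ σ → revenue G σ ≤ revenueIE G A ½
  bound σ = ≤-trans {revenue G σ} {¼ * cut} {revenueIE G A ½}
    (revenue-sum≤cut π {¼} (λ i → p i * (1ℝ - p i)) p
      (pointwise-≤ {0ℝ} {¼} λ _ → ℚ.nonNegative⁻¹ _)
      (λ i → pointwise-≤ {p i * (1ℝ - p i)} {¼} λ k → p*[1-p]≤½*[1-½] (seq (p i) k))
      (λ j → ≤-trans {0ℝ} {½} {p j}
        (pointwise-≤ {0ℝ} {½} λ _ → ℚ.nonNegative⁻¹ ℚ.½) (½≤p j))
      p≤1)
    (≃⇒≤ {¼ * cut} {revenueIE G A ½} ¼cut≃IE)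
    where open Strategy σ
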